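{- For every fixed $0<\epsilon<\frac12$, $$R^{\mathrm{oot}}_\epsilon(\mathrm{MAX}_n)\in O(\log n),\qquad R^{\mathrm{uni}}_\epsilon(\mathrm{MAX}_n)\in\Omega(n),$$ and the same asymptotic gap (up to multiplicative and additive constants) holds when only private coins are allowed.
   Context: $\mathrm{MAX}_n:\{0,1\}^n\times\{0,1\}^n\to\{0,1\}^n$ is $\mathrm{MAX}_n(x,y)=x$ if $x\ge y$ and $y$ otherwise, comparing strings as binary integers. Two-party communication with private randomness $r_A,r_B$, public randomness $r$, transcript $t_\pi$ (exchanged bits, public randomness excluded), cost = maximum number of bits exchanged. Output models with error $\epsilon$ (correct with probability at least $1-\epsilon$ on every input), output maps $O_A(t_\pi,r,r_A,x)$, $O_B(t_\pi,r,r_B,y)$: Alice (resp. Bob) model — $O_A=f(x,y)$ (resp. $O_B=f(x,y)$); one-out-of-two — values in $\{0,1\}^n\cup\{\top\}$ and $(O_A,O_B)\in\{(f(x,y),\top),(\top,f(x,y))\}$. $R^{\mathrm{oot}}_\epsilon$ is the minimum one-out-of-two cost and $R^{\mathrm{uni}}_\epsilon=\min(R^A_\epsilon,R^B_\epsilon)$, with public and private coins allowed (the private-coin versions restrict to private randomness only). Logarithms base 2. -}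

module Defs where

open import Data.Bool using (Bool; true; false; if_then_else_)
import Data.Bool as B
open import Data.Nat using (ℕ; zero; suc; _+_; _*_; _∸_; _^_; _≤_; _<_; _≤ᵇ_; _⊔_)
open import Data.Nat.Logarithm using (⌈log₂_⌉)
open import Data.Vec using (Vec; []; _∷_)
open import Data.Vec.Properties using (≡-dec)
open import Data.List using (List; []; _∷_; map; concatMap; _++_)
open import Data.Maybe using (Maybe; just; nothing)
open import Data.Product using (Σ; _×_; _,_; ∃-syntax)
open import Data.Sum using (_⊎_)
open import Relation.Nullary using (does)
open import Relation.Binary.PropositionalEquality using (_≡_)

-- n-bit strings; the first bit is the most significant one
Bits : ℕ → Set
Bits n = Vec Bool n

val : {n : ℕ} → Bits n → ℕ
val [] = 0
val {suc n} (b ∷ v) = (if b then 2 ^ n else 0) + val v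

MAX : (n : ℕ) → Bits n → Bits n → Bits n
MAX n x y = if val y ≤ᵇ val x then x else y

eqBits : {n : ℕ} → Bits n → Bits n → Bool
eqBits u v = does (≡-dec B._≟_ u v)

allBits : (k : ℕ) → List (Bits k)
allBits zero = [] ∷ []
allBits (suc k) = map (false ∷_) (allBits k) ++ map (true ∷_) (allBits k)

count : {A : Set} → (A → Bool) → List A → ℕ
count p [] = 0
count p (a ∷ as) = (if p a then 1 else 0) + count p as

sumL : {A : Set} → (A → ℕ) → List A → ℕ
sumL f [] = 0
sumL f (a ∷ as) = f a + sumL f as

-- Deterministic protocol trees.  VA = Alice's local view, VB = Bob's.
-- At each internal node the speaker (determined by the position in the
-- tree, i.e. by the history) sends one bit computed from its view.

data Protocol (VA VB : Set) : Set where
  done  : Protocol VA VB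
  sendA : (VA → Bool) → (Bool → Protocol VA VB) → Protocol VA VB
  sendB : (VB → Bool) → (Bool → Protocol VA VB) → Protocol VA VB

depth : {VA VB : Set} → Protocol VA VB → ℕ
depth done = 0
depth (sendA m k) = suc (depth (k false) ⊔ depth (k true))
depth (sendB m k) = suc (depth (k false) ⊔ depth (k true))

transcript : {VA VB : Set} → Protocol VA VB → VA → VB → List Bool
transcript done a b = []
transcript (sendA m k) a b = m a ∷ transcript (k (m a)) a b
transcript (sendB m k) a b = m b ∷ transcript (k (m b)) a b

-- Randomized protocols for inputs in {0,1}^n × {0,1}^n with
-- kp public random bits r, ka private bits r_A, kb private bits r_B
-- (all uniform and independent).  The tree may depend on r; Alice's
-- view is (x , r_A), Bob's view is (y , r_B).  Outputs have type OA / OB.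

record RProtocol (n : ℕ) (OA OB : Set) : Set where
  field
    kp ka kb : ℕ
    tree : Bits kp → Protocol (Bits n × Bits ka) (Bits n × Bits kb)
    outA : List Bool → Bits kp → Bits ka → Bits n → OA
    outB : List Bool → Bits kp → Bits kb → Bits n → OB

  Cost≤ : ℕ → Set
  Cost≤ c = (r : Bits kp) → depth (tree r) ≤ c

  run : Bits n → Bits n → Bits kp → Bits ka → Bits kb → OA × OB
  run x y r rA rB =
    let t = transcript (tree r) (x , rA) (y , rB)
    in outA t r rA x , outB t r rB y

  goodCount : (OA × OB → Bool) → Bits n → Bits n → ℕ
  goodCount good x y =
    sumL (λ r → sumL (λ rA → count (λ rB → good (run x y r rA rB))
                                    (allBits kb))
                      (allBits ka))
         (allBits kp)

  -- error at most ε = p / q on every input: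
  --   Pr[good] ≥ 1 - p/q   i.e.   q · #good ≥ (q - p) · 2^(kp+ka+kb)
  ErrorAtMost : ℕ → ℕ → (OA × OB → Bits n → Bits n → Bool) → Set
  ErrorAtMost p q good =
    (x y : Bits n) →
      (q ∸ p) * (2 ^ kp * 2 ^ ka * 2 ^ kb) ≤ q * goodCount (λ o → good o x y) x y

  PrivateCoin : Set
  PrivateCoin = kp ≡ 0

open RProtocol public

-- output value in {0,1}^n ∪ {⊤}; nothing = ⊤
OutT : ℕ → Set
OutT n = Maybe (Bits n)

isOut : {n : ℕ} → OutT n → Bits n → Bool
isOut (just v) w = eqBits v w
isOut nothing w = false

isTop : {n : ℕ} → OutT n → Bool
isTop (just _) = false
isTop nothing = true

oot-good : (n : ℕ) → OutT n × OutT n → Bits n → Bits n → Bool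
oot-good n (oa , ob) x y =
  (isOut oa (MAX n x y) B.∧ isTop ob) B.∨ (isTop oa B.∧ isOut ob (MAX n x y))

alice-good : (n : ℕ) → Bits n × Bits n → Bits n → Bits n → Bool
alice-good n (oa , ob) x y = eqBits oa (MAX n x y)

bob-good : (n : ℕ) → Bits n × Bits n → Bits n → Bits n → Bool
bob-good n (oa , ob) x y = eqBits ob (MAX n x y)

OOT≤ : ℕ → ℕ → ℕ → ℕ → Set
OOT≤ p q n c = Σ (RProtocol n (OutT n) (OutT n)) λ π →
  Cost≤ π c × ErrorAtMost π p q (oot-good n)

OOTpriv≤ : ℕ → ℕ → ℕ → ℕ → Set
OOTpriv≤ p q n c = Σ (RProtocol n (OutT n) (OutT n)) λ π →
  PrivateCoin π × Cost≤ π c × ErrorAtMost π p q (oot-good n)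

Alice≤ Bob≤ Alicepriv≤ Bobpriv≤ : ℕ → ℕ → ℕ → ℕ → Set
Alice≤ p q n c = Σ (RProtocol n (Bits n) (Bits n)) λ π →
  Cost≤ π c × ErrorAtMost π p q (alice-good n)
Bob≤ p q n c = Σ (RProtocol n (Bits n) (Bits n)) λ π →
  Cost≤ π c × ErrorAtMost π p q (bob-good n)
Alicepriv≤ p q n c = Σ (RProtocol n (Bits n) (Bits n)) λ π →
  PrivateCoin π × Cost≤ π c × ErrorAtMost π p q (alice-good n)
Bobpriv≤ p q n c = Σ (RProtocol n (Bits n) (Bits n)) λ π →
  PrivateCoin π × Cost≤ π c × ErrorAtMost π p q (bob-good n)

-- R^uni = min(R^A, R^B):  "R^uni ≤ c"  iff  R^A ≤ c or R^B ≤ c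
Uni≤ Unipriv≤ : ℕ → ℕ → ℕ → ℕ → Set
Uni≤ p q n c = Alice≤ p q n c ⊎ Bob≤ p q n c
Unipriv≤ p q n c = Alicepriv≤ p q n c ⊎ Bobpriv≤ p q n c

{-# OPTIONS --safe #-}

-- Lower bound: take x = 0. With all coins fixed, Alice's output depends on y only through the
-- transcript, so she is right for at most 2^c of the 2^n strings y; averaging gives
-- 2^n (1 - ε) ≤ 2^c, hence n ≤ c. Bob's model is symmetric.
--
-- Upper bound: locate the first difference of x·1 and y·0 by a binary search that compares prefixes
-- through hashes of constantly many bits and backtracks when the left end of its interval is seen
-- to be wrong. A failed comparison undoes at most one step, so 3d steps in a tree of depth d only
-- go wrong after more than d failures. Instead of drawing the hashes with public coins, they are
-- fixed greedily for 2^k ≥ n runs (as in Newman's theorem) so that every input (x , y) sees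
-- few failures in total; by Markov's inequality few runs are then wrong on it. Alice's private
-- coins are the k bits naming the run, which she sends first.

module Submission where

open import Defs
open import Data.Bool using (Bool; true; false; if_then_else_; not; _∧_; _xor_)
import Data.Bool as B
open import Data.List using (List; []; _∷_; map; _++_; length; cartesianProductWith)
open import Data.List.Membership.Propositional using (_∈_)
open import Data.List.Membership.Propositional.Properties using (∈-++⁺ˡ; ∈-++⁺ʳ; ∈-map⁺; ∈-cartesianProductWith⁺)
open import Data.List.Properties using (length-++; length-map)
open import Data.List.Relation.Unary.Any using (here; there)
open import Data.Maybe using (just; nothing)
open import Data.Nat using (ℕ; zero; suc; _+_; _*_; _∸_; _^_; _≤_; _<_; _≤ᵇ_; _⊔_; z≤n; s≤s; NonZero; ⌈_/2⌉; ⌊_/2⌋; >-nonZero)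
open import Data.Nat.Induction using (<-wellFounded)
open import Data.Nat.Logarithm using (⌈log₂_⌉)
open import Data.Nat.Logarithm.Core using (⌈log2⌉)
open import Data.Nat.Properties
open import Data.Nat.Tactic.RingSolver using (solve-∀)
open import Data.Product using (∃-syntax; _×_; _,_; proj₁; proj₂)
open import Data.Sum using (_⊎_; inj₁; inj₂)
open import Data.Vec using (Vec; []; _∷_; _∷ʳ_; replicate; head; tail)
open import Data.Vec.Properties using (≡-dec; ∷-injective)
open import Function using (_∘_)
open import Induction.WellFounded using (Acc; acc)
open import Relation.Binary.PropositionalEquality using (_≡_; _≢_; refl; sym; trans; cong; cong₂; subst; module ≡-Reasoning)
open import Relation.Nullary using (does; yes; no; contradiction)
open import Relation.Nullary.Decidable using (dec-true; dec-false)

𝟙 : Bool → ℕ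
𝟙 b = if b then 1 else 0

-- Finite sums

module _ {A : Set} where

  sumL-mono : {f g : A → ℕ} (as : List A) → (∀ a → f a ≤ g a) → sumL f as ≤ sumL g as
  sumL-mono []       f≤g = z≤n
  sumL-mono (a ∷ as) f≤g = +-mono-≤ (f≤g a) (sumL-mono as f≤g)

  sumL-cong : {f g : A → ℕ} (as : List A) → (∀ a → f a ≡ g a) → sumL f as ≡ sumL g as
  sumL-cong []       f≡g = refl
  sumL-cong (a ∷ as) f≡g = cong₂ _+_ (f≡g a) (sumL-cong as f≡g)

  sumL-+ : (f g : A → ℕ) (as : List A) → sumL (λ a → f a + g a) as ≡ sumL f as + sumL g as
  sumL-+ f g []       = refl
  sumL-+ f g (a ∷ as) rewrite sumL-+ f g as = interchange (f a) (g a) (sumL f as) (sumL g as)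
    where
    interchange : ∀ x y z w → x + y + (z + w) ≡ x + z + (y + w)
    interchange = solve-∀

  sumL-*ˡ : (k : ℕ) (f : A → ℕ) (as : List A) → sumL (λ a → k * f a) as ≡ k * sumL f as
  sumL-*ˡ k f []       = sym (*-zeroʳ k)
  sumL-*ˡ k f (a ∷ as) rewrite sumL-*ˡ k f as = sym (*-distribˡ-+ k (f a) (sumL f as))

  sumL-*ʳ : (k : ℕ) (f : A → ℕ) (as : List A) → sumL (λ a → f a * k) as ≡ sumL f as * k
  sumL-*ʳ k f as = begin
    sumL (λ a → f a * k) as  ≡⟨ sumL-cong as (λ a → *-comm (f a) k) ⟩
    sumL (λ a → k * f a) as  ≡⟨ sumL-*ˡ k f as ⟩
    k * sumL f as            ≡⟨ *-comm k _ ⟩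
    sumL f as * k            ∎
    where open ≡-Reasoning

  sumL-const : (k : ℕ) (as : List A) → sumL (λ _ → k) as ≡ length as * k
  sumL-const k []       = refl
  sumL-const k (a ∷ as) = cong (k +_) (sumL-const k as)

  sumL-++ : (f : A → ℕ) (as bs : List A) → sumL f (as ++ bs) ≡ sumL f as + sumL f bs
  sumL-++ f []       bs = refl
  sumL-++ f (a ∷ as) bs rewrite sumL-++ f as bs = sym (+-assoc (f a) _ _)

  count≡sumL : (p : A → Bool) (as : List A) → count p as ≡ sumL (𝟙 ∘ p) as
  count≡sumL p []       = refl
  count≡sumL p (a ∷ as) = cong (𝟙 (p a) +_) (count≡sumL p as)

  sumL-∈ : (f : A → ℕ) {a : A} {as : List A} → a ∈ as → f a ≤ sumL f as
  sumL-∈ f (here refl) = m≤m+n _ _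
  sumL-∈ f (there {x} a∈) = ≤-trans (sumL-∈ f a∈) (m≤n+m _ (f x))

  sumL-≤-average : {F : A → ℕ} {K : ℕ} (as : List A) → 0 < length as →
    sumL F as ≤ length as * K → ∃[ a ] F a ≤ K
  sumL-≤-average {F} {K} (a ∷ as) _ Σ≤ with F a ≤? K
  ... | yes Fa≤K = a , Fa≤K
  sumL-≤-average {F} {K} (a ∷ [])         _ Σ≤ | no Fa≰K =
    contradiction (+-cancelʳ-≤ 0 (F a) K Σ≤) Fa≰K
  sumL-≤-average {F} {K} (a ∷ as@(_ ∷ _)) _ Σ≤ | no Fa≰K =
    sumL-≤-average as (s≤s z≤n)
      (+-cancelˡ-≤ K _ _ (≤-trans (+-monoˡ-≤ (sumL F as) (<⇒≤ (≰⇒> Fa≰K))) Σ≤))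

module _ {A B : Set} where

  sumL-map : (f : B → ℕ) (g : A → B) (as : List A) → sumL f (map g as) ≡ sumL (f ∘ g) as
  sumL-map f g []       = refl
  sumL-map f g (a ∷ as) = cong (f (g a) +_) (sumL-map f g as)

  sumL-swap : (f : A → B → ℕ) (as : List A) (bs : List B) →
    sumL (λ a → sumL (f a) bs) as ≡ sumL (λ b → sumL (λ a → f a b) as) bs
  sumL-swap f []       bs = sym (trans (sumL-const 0 bs) (*-zeroʳ (length bs)))
  sumL-swap f (a ∷ as) bs rewrite sumL-swap f as bs =
    sym (sumL-+ (f a) (λ b → sumL (λ a → f a b) as) bs)

module _ {A B C : Set} where

  length-cartesianProductWith : (f : A → B → C) (as : List A) (bs : List B) →
    length (cartesianProductWith f as bs) ≡ length as * length bs
  length-cartesianProductWith f []       bs = refl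
  length-cartesianProductWith f (a ∷ as) bs = begin
    length (map (f a) bs ++ cartesianProductWith f as bs)
      ≡⟨ length-++ (map (f a) bs) ⟩
    length (map (f a) bs) + length (cartesianProductWith f as bs)
      ≡⟨ cong₂ _+_ (length-map (f a) bs) (length-cartesianProductWith f as bs) ⟩
    length bs + length as * length bs ∎
    where open ≡-Reasoning

  sumL-cartesianProductWith : (g : C → ℕ) (f : A → B → C) (as : List A) (bs : List B) →
    sumL g (cartesianProductWith f as bs) ≡ sumL (λ a → sumL (λ b → g (f a b)) bs) as
  sumL-cartesianProductWith g f []       bs = refl
  sumL-cartesianProductWith g f (a ∷ as) bs =
    trans (sumL-++ g (map (f a) bs) _)
      (cong₂ _+_ (sumL-map g (f a) bs) (sumL-cartesianProductWith g f as bs))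

-- Bit strings

sumL-allBits : (k : ℕ) (f : Bits (suc k) → ℕ) →
  sumL f (allBits (suc k)) ≡ sumL (f ∘ (false ∷_)) (allBits k) + sumL (f ∘ (true ∷_)) (allBits k)
sumL-allBits k f = trans (sumL-++ f (map (false ∷_) (allBits k)) _)
  (cong₂ _+_ (sumL-map f (false ∷_) (allBits k)) (sumL-map f (true ∷_) (allBits k)))

length-allBits : (k : ℕ) → length (allBits k) ≡ 2 ^ k
length-allBits zero    = refl
length-allBits (suc k) = begin
  length (map (false ∷_) (allBits k) ++ map (true ∷_) (allBits k))
    ≡⟨ length-++ (map (false ∷_) (allBits k)) ⟩
  length (map (false ∷_) (allBits k)) + length (map (true ∷_) (allBits k))
    ≡⟨ cong₂ _+_ (length-map (false ∷_) (allBits k)) (length-map (true ∷_) (allBits k)) ⟩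
  length (allBits k) + length (allBits k)
    ≡⟨ cong₂ _+_ (length-allBits k) (trans (length-allBits k) (sym (+-identityʳ (2 ^ k)))) ⟩
  2 ^ suc k ∎
  where open ≡-Reasoning

sumL-allBits-const : (k c : ℕ) → sumL (λ _ → c) (allBits k) ≡ 2 ^ k * c
sumL-allBits-const k c = trans (sumL-const c (allBits k)) (cong (_* c) (length-allBits k))

∈-allBits : {k : ℕ} (v : Bits k) → v ∈ allBits k
∈-allBits []          = here refl
∈-allBits (false ∷ v) = ∈-++⁺ˡ (∈-map⁺ (false ∷_) (∈-allBits v))
∈-allBits (true  ∷ v) = ∈-++⁺ʳ (map (false ∷_) (allBits _)) (∈-map⁺ (true ∷_) (∈-allBits v))

eqBits-refl : {n : ℕ} (u : Bits n) → eqBits u u ≡ true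
eqBits-refl u = dec-true (≡-dec B._≟_ u u) refl

eqBits-true⇒≡ : {n : ℕ} (u v : Bits n) → eqBits u v ≡ true → u ≡ v
eqBits-true⇒≡ u v e with ≡-dec B._≟_ u v
... | yes u≡v = u≡v
eqBits-true⇒≡ u v () | no _

eqBits-false⇒≢ : {n : ℕ} (u v : Bits n) → eqBits u v ≡ false → u ≢ v
eqBits-false⇒≢ u .u e refl with () ← trans (sym (eqBits-refl u)) e

count-eqBits≤1 : {n : ℕ} (w : Bits n) → count (eqBits w) (allBits n) ≤ 1
count-eqBits≤1 {n} w = subst (_≤ 1) (sym (count≡sumL (eqBits w) (allBits n))) (bound w)
  where
  zeros : ∀ k → sumL (λ (_ : Bits k) → 0) (allBits k) ≡ 0
  zeros k = trans (sumL-allBits-const k 0) (*-zeroʳ (2 ^ k))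
  bound : ∀ {k} (w : Bits k) → sumL (𝟙 ∘ eqBits w) (allBits k) ≤ 1
  bound []                  = ≤-refl
  bound {suc k} (false ∷ w)
    rewrite sumL-allBits k (𝟙 ∘ eqBits (false ∷ w)) | zeros k | +-identityʳ (sumL (𝟙 ∘ eqBits w) (allBits k)) = bound w
  bound {suc k} (true  ∷ w)
    rewrite sumL-allBits k (𝟙 ∘ eqBits (true ∷ w)) | zeros k = bound w

val<2^n : {n : ℕ} (x : Bits n) → val x < 2 ^ n
val<2^n []          = s≤s z≤n
val<2^n {suc n} (false ∷ x) = ≤-trans (val<2^n x) (m≤m+n (2 ^ n) _)
val<2^n {suc n} (true  ∷ x) = +-monoʳ-< (2 ^ n) (≤-trans (val<2^n x) (m≤m+n (2 ^ n) 0))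

-- Lower bound

zeroBits : (n : ℕ) → Bits n
zeroBits n = replicate n false

val-zeroBits : (n : ℕ) → val (zeroBits n) ≡ 0
val-zeroBits zero    = refl
val-zeroBits (suc n) = val-zeroBits n

val≡0⇒zeroBits : {n : ℕ} (y : Bits n) → val y ≡ 0 → y ≡ zeroBits n
val≡0⇒zeroBits []          _ = refl
val≡0⇒zeroBits (false ∷ y) e = cong (false ∷_) (val≡0⇒zeroBits y e)
val≡0⇒zeroBits {suc n} (true ∷ y) e =
  contradiction (m+n≡0⇒m≡0 (2 ^ n) e) (>⇒≢ (m^n>0 2 n))

MAX-zeroBitsʳ : {n : ℕ} (x : Bits n) → MAX n x (zeroBits n) ≡ x
MAX-zeroBitsʳ {n} x rewrite val-zeroBits n = refl

MAX-zeroBitsˡ : {n : ℕ} (y : Bits n) → MAX n (zeroBits n) y ≡ y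
MAX-zeroBitsˡ {n} y rewrite val-zeroBits n with val y in eq
-- On this tie `MAX` returns its first argument, which equals `y` because both are the zero string.
... | zero  = sym (val≡0⇒zeroBits y eq)
... | suc _ = refl

-- Induction on the tree, with `g` generalised so that below a node it has already read the bit sent
-- there. A leaf, having a fixed transcript, contributes at most 1, and each level at most doubles
-- the bound.
count-transcript≤ : {VA VB Z : Set} (zs : List Z) (va : Z → VA) (vb : Z → VB)
  (T : Protocol VA VB) (g : List Bool → Z → Bool) → (∀ t → count (g t) zs ≤ 1) →
  count (λ z → g (transcript T (va z) (vb z)) z) zs ≤ 2 ^ depth T
count-transcript≤ zs va vb T g unique =
  subst (_≤ 2 ^ depth T) (sym (count≡sumL _ zs))
    (bound T g λ t → subst (_≤ 1) (count≡sumL (g t) zs) (unique t))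
  where
  hits : (T : Protocol _ _) → (List Bool → _ → Bool) → ℕ
  hits T g = sumL (λ z → 𝟙 (g (transcript T (va z) (vb z)) z)) zs

  branch : ∀ b {f : Bool → ℕ} → f b ≤ f false + f true
  branch false = m≤m+n _ _
  branch true  = m≤n+m _ _

  double : ∀ {x y} m n → x ≤ 2 ^ m → y ≤ 2 ^ n → x + y ≤ 2 ^ suc (m ⊔ n)
  double m n x≤ y≤ = +-mono-≤ (≤-trans x≤ (^-monoʳ-≤ 2 (m≤m⊔n m n)))
    (≤-trans (≤-trans y≤ (^-monoʳ-≤ 2 (m≤n⊔m m n))) (m≤m+n _ 0))

  bound : (T : Protocol _ _) (g : List Bool → _ → Bool) →
    (∀ t → sumL (𝟙 ∘ g t) zs ≤ 1) → hits T g ≤ 2 ^ depth T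
  split : (k : Bool → Protocol _ _) (m : _ → Bool) (g : List Bool → _ → Bool) →
    (∀ t → sumL (𝟙 ∘ g t) zs ≤ 1) →
    sumL (λ z → 𝟙 (g (m z ∷ transcript (k (m z)) (va z) (vb z)) z)) zs
      ≤ 2 ^ suc (depth (k false) ⊔ depth (k true))
  bound done        g u = u []
  bound (sendA m k) g u = split k (m ∘ va) g u
  bound (sendB m k) g u = split k (m ∘ vb) g u
  -- Instead of dividing `zs` according to the bit sent, every `z` is counted in both subtrees,
  -- which only enlarges the sum.
  split k m g u = ≤-trans
    (sumL-mono zs λ z → branch (m z) {λ b → 𝟙 (g (b ∷ transcript (k b) (va z) (vb z)) z)})
    (≤-trans (≤-reflexive (sumL-+ _ _ zs))
      (double (depth (k false)) (depth (k true))
              (bound (k false) (g ∘ (false ∷_)) (u ∘ (false ∷_)))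
              (bound (k true)  (g ∘ (true ∷_))  (u ∘ (true ∷_)))))

-- Average over z: at most 2^c of the 2^n inputs are answered correctly for any fixed coins.
n≤cost : (p q n c : ℕ) → 2 * p < q → {OA OB : Set} (π : RProtocol n OA OB)
  (good : OA × OB → Bits n → Bits n → Bool) (X Y : Bits n → Bits n) →
  (∀ r rA rB t → count (λ z → good (outA π t r rA (X z) , outB π t r rB (Y z)) (X z) (Y z)) (allBits n) ≤ 1) →
  Cost≤ π c → ErrorAtMost π p q good → n ≤ c
n≤cost p q n c 2p<q π good X Y unique cost≤ err≤ with n ≤? c
... | yes n≤c = n≤c
... | no n≰c = contradiction averaged (<⇒≱ strict)
  where
  W = 2 ^ kp π * 2 ^ ka π * 2 ^ kb π
  gc : Bits n → ℕ
  gc z = goodCount π (λ o → good o (X z) (Y z)) (X z) (Y z)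

  fixed : ∀ r rA rB → sumL (λ z → 𝟙 (good (run π (X z) (Y z) r rA rB) (X z) (Y z))) (allBits n) ≤ 2 ^ c
  fixed r rA rB = subst (_≤ 2 ^ c) (count≡sumL _ (allBits n))
    (≤-trans
      (count-transcript≤ (allBits n) (λ z → X z , rA) (λ z → Y z , rB) (tree π r)
        (λ t z → good (outA π t r rA (X z) , outB π t r rB (Y z)) (X z) (Y z)) (unique r rA rB))
      (^-monoʳ-≤ 2 (cost≤ r)))

  totalGood : sumL gc (allBits n) ≤ W * 2 ^ c
  totalGood = begin
    sumL gc (allBits n)
      -- The sum over `z` is moved inwards past all three kinds of coins, so that `fixed` applies to
      -- each choice of them.
      ≡⟨ sumL-swap _ (allBits n) (allBits (kp π)) ⟩
    sumL (λ r → sumL (λ z → sumL (λ rA → count (λ rB → ok z r rA rB) (allBits (kb π))) (allBits (ka π))) (allBits n)) (allBits (kp π))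
      ≤⟨ sumL-mono (allBits (kp π)) (λ r → begin
        sumL (λ z → sumL (λ rA → count (λ rB → ok z r rA rB) (allBits (kb π))) (allBits (ka π))) (allBits n)
          ≡⟨ sumL-swap _ (allBits n) (allBits (ka π)) ⟩
        sumL (λ rA → sumL (λ z → count (λ rB → ok z r rA rB) (allBits (kb π))) (allBits n)) (allBits (ka π))
          ≤⟨ sumL-mono (allBits (ka π)) (λ rA → begin
            sumL (λ z → count (λ rB → ok z r rA rB) (allBits (kb π))) (allBits n)
              ≡⟨ sumL-cong (allBits n) (λ z → count≡sumL _ (allBits (kb π))) ⟩
            sumL (λ z → sumL (λ rB → 𝟙 (ok z r rA rB)) (allBits (kb π))) (allBits n)
              ≡⟨ sumL-swap _ (allBits n) (allBits (kb π)) ⟩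
            sumL (λ rB → sumL (λ z → 𝟙 (ok z r rA rB)) (allBits n)) (allBits (kb π))
              ≤⟨ sumL-mono (allBits (kb π)) (fixed r rA) ⟩
            sumL (λ _ → 2 ^ c) (allBits (kb π))
              ≡⟨ sumL-allBits-const (kb π) (2 ^ c) ⟩
            2 ^ kb π * 2 ^ c ∎) ⟩
        sumL (λ _ → 2 ^ kb π * 2 ^ c) (allBits (ka π))
          ≡⟨ sumL-allBits-const (ka π) _ ⟩
        2 ^ ka π * (2 ^ kb π * 2 ^ c) ∎) ⟩
    sumL (λ _ → 2 ^ ka π * (2 ^ kb π * 2 ^ c)) (allBits (kp π))
      ≡⟨ sumL-allBits-const (kp π) _ ⟩
    2 ^ kp π * (2 ^ ka π * (2 ^ kb π * 2 ^ c))
      ≡⟨ reassoc (2 ^ kp π) (2 ^ ka π) (2 ^ kb π) (2 ^ c) ⟩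
    W * 2 ^ c ∎
    where
    open ≤-Reasoning
    ok : Bits n → Bits (kp π) → Bits (ka π) → Bits (kb π) → Bool
    ok z r rA rB = good (run π (X z) (Y z) r rA rB) (X z) (Y z)
    reassoc : ∀ a b c d → a * (b * (c * d)) ≡ a * b * c * d
    reassoc = solve-∀

  instance
    W≢0 : NonZero W
    W≢0 = m*n≢0 (2 ^ kp π * 2 ^ ka π) (2 ^ kb π) {{m*n≢0 (2 ^ kp π) (2 ^ ka π) {{m^n≢0 2 (kp π)}} {{m^n≢0 2 (ka π)}}}} {{m^n≢0 2 (kb π)}}
    2^c≢0 : NonZero (2 ^ c)
    2^c≢0 = m^n≢0 2 c

  averaged : (q ∸ p) * 2 ^ n ≤ q * 2 ^ c
  averaged = *-cancelˡ-≤ W (begin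
    W * ((q ∸ p) * 2 ^ n)
      ≡⟨ rearrange W (q ∸ p) (2 ^ n) ⟩
    2 ^ n * ((q ∸ p) * W)
      ≡⟨ sumL-allBits-const n _ ⟨
    sumL (λ _ → (q ∸ p) * W) (allBits n)
      ≤⟨ sumL-mono (allBits n) (λ z → err≤ (X z) (Y z)) ⟩
    sumL (λ z → q * gc z) (allBits n)
      ≡⟨ sumL-*ˡ q gc (allBits n) ⟩
    q * sumL gc (allBits n)
      ≤⟨ *-monoʳ-≤ q totalGood ⟩
    q * (W * 2 ^ c)
      ≡⟨ swap q W (2 ^ c) ⟩
    W * (q * 2 ^ c) ∎)
    where
    open ≤-Reasoning
    rearrange : ∀ a b c → a * (b * c) ≡ c * (b * a)
    rearrange = solve-∀
    swap : ∀ a b c → a * (b * c) ≡ b * (a * c)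
    swap = solve-∀

  -- Missing a single bit is already contradictory: `2 * p < q` gives `q < (q ∸ p) * 2`, and `c < n`
  -- absorbs the factor 2.
  strict : q * 2 ^ c < (q ∸ p) * 2 ^ n
  strict = begin-strict
    q * 2 ^ c              <⟨ *-monoˡ-< (2 ^ c) q<2[q-p] ⟩
    (q ∸ p) * 2 * 2 ^ c    ≡⟨ *-assoc (q ∸ p) 2 (2 ^ c) ⟩
    (q ∸ p) * 2 ^ suc c    ≤⟨ *-monoʳ-≤ (q ∸ p) (^-monoʳ-≤ 2 (≰⇒> n≰c)) ⟩
    (q ∸ p) * 2 ^ n        ∎
    where
    open ≤-Reasoning
    p≤q : p ≤ q
    p≤q = ≤-trans (m≤m+n p _) (<⇒≤ 2p<q)
    r+p≡q : (q ∸ p) + p ≡ q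
    r+p≡q = m∸n+n≡m p≤q
    p<q-p : p < q ∸ p
    p<q-p = +-cancelʳ-< p p (q ∸ p) (begin-strict
      p + p        ≡⟨ cong (p +_) (+-identityʳ p) ⟨
      2 * p        <⟨ 2p<q ⟩
      q            ≡⟨ r+p≡q ⟨
      q ∸ p + p    ∎)
    q<2[q-p] : q < (q ∸ p) * 2
    q<2[q-p] = begin-strict
      q                    ≡⟨ r+p≡q ⟨
      q ∸ p + p            <⟨ +-monoʳ-< (q ∸ p) p<q-p ⟩
      q ∸ p + (q ∸ p)      ≡⟨ cong (q ∸ p +_) (+-identityʳ (q ∸ p)) ⟨
      2 * (q ∸ p)          ≡⟨ *-comm 2 (q ∸ p) ⟩
      (q ∸ p) * 2          ∎

uni-lower-bound : (p q n c : ℕ) → 2 * p < q → Uni≤ p q n c → n ≤ c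
uni-lower-bound p q n c 2p<q (inj₁ (π , cost≤ , err≤)) =
  n≤cost p q n c 2p<q π (alice-good n) (λ _ → zeroBits n) (λ y → y) unique cost≤ err≤
  where
  unique : ∀ r rA rB t → count (λ y → eqBits (outA π t r rA (zeroBits n)) (MAX n (zeroBits n) y)) (allBits n) ≤ 1
  unique r rA rB t = subst (_≤ 1)
    (trans (count≡sumL _ (allBits n)) (trans (sumL-cong (allBits n) λ y → cong (𝟙 ∘ eqBits w) (sym (MAX-zeroBitsˡ y))) (sym (count≡sumL _ (allBits n)))))
    (count-eqBits≤1 w)
    where w = outA π t r rA (zeroBits n)
uni-lower-bound p q n c 2p<q (inj₂ (π , cost≤ , err≤)) =
  n≤cost p q n c 2p<q π (bob-good n) (λ x → x) (λ _ → zeroBits n) unique cost≤ err≤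
  where
  unique : ∀ r rA rB t → count (λ x → eqBits (outB π t r rB (zeroBits n)) (MAX n x (zeroBits n))) (allBits n) ≤ 1
  unique r rA rB t = subst (_≤ 1)
    (trans (count≡sumL _ (allBits n)) (trans (sumL-cong (allBits n) λ x → cong (𝟙 ∘ eqBits w) (sym (MAX-zeroBitsʳ x))) (sym (count≡sumL _ (allBits n)))))
    (count-eqBits≤1 w)
    where w = outB π t r rB (zeroBits n)

unipriv-lower-bound : (p q n c : ℕ) → 2 * p < q → Unipriv≤ p q n c → n ≤ c
unipriv-lower-bound p q n c 2p<q (inj₁ (π , _ , rest)) = uni-lower-bound p q n c 2p<q (inj₁ (π , rest))
unipriv-lower-bound p q n c 2p<q (inj₂ (π , _ , rest)) = uni-lower-bound p q n c 2p<q (inj₂ (π , rest))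

-- Linear hashing

dot : {n : ℕ} → Bits n → Bits n → Bool
dot []       []       = false
dot (s ∷ ss) (u ∷ us) = (s ∧ u) xor dot ss us

-- A random inner product over the two-element field separates distinct strings with probability one
-- half. If the heads agree, the tails differ and induction applies; if they differ, the two values
-- of the first bit of `s` give opposite outcomes.
dot-collisions : {n : ℕ} {u v : Bits n} → u ≢ v →
  sumL (λ s → 𝟙 (does (dot s u B.≟ dot s v))) (allBits n) * 2 ≤ 2 ^ n
dot-collisions {u = []}    {[]}    u≢v = contradiction refl u≢v
dot-collisions {suc n} {a ∷ u} {b ∷ v} u≢v
  rewrite sumL-allBits n (λ s → 𝟙 (does (dot s (a ∷ u) B.≟ dot s (b ∷ v)))) = cases a b u≢v
  where
  agree : Bits n → Bool
  agree s = does (dot s u B.≟ dot s v)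

  not-≟ : ∀ x y → 𝟙 (does (not x B.≟ not y)) ≡ 𝟙 (does (x B.≟ y))
  not-≟ false false = refl
  not-≟ false true  = refl
  not-≟ true  false = refl
  not-≟ true  true  = refl

  complementʳ : ∀ x y → 𝟙 (does (x B.≟ y)) + 𝟙 (does (x B.≟ not y)) ≡ 1
  complementʳ false false = refl
  complementʳ false true  = refl
  complementʳ true  false = refl
  complementʳ true  true  = refl

  complementˡ : ∀ x y → 𝟙 (does (x B.≟ y)) + 𝟙 (does (not x B.≟ y)) ≡ 1
  complementˡ false false = refl
  complementˡ false true  = refl
  complementˡ true  false = refl
  complementˡ true  true  = refl

  same : (f : Bits n → ℕ) → (∀ s → f s ≡ 𝟙 (agree s)) → u ≢ v →
    (sumL (𝟙 ∘ agree) (allBits n) + sumL f (allBits n)) * 2 ≤ 2 ^ suc n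
  same f f≡ u≢v rewrite sumL-cong (allBits n) f≡ = begin
    (K + K) * 2      ≡⟨ lemma K ⟩
    2 * (K * 2)      ≤⟨ *-monoʳ-≤ 2 (dot-collisions u≢v) ⟩
    2 ^ suc n        ∎
    where
    open ≤-Reasoning
    K = sumL (𝟙 ∘ agree) (allBits n)
    lemma : ∀ k → (k + k) * 2 ≡ 2 * (k * 2)
    lemma = solve-∀

  opposite : (f : Bits n → ℕ) → (∀ s → 𝟙 (agree s) + f s ≡ 1) →
    (sumL (𝟙 ∘ agree) (allBits n) + sumL f (allBits n)) * 2 ≤ 2 ^ suc n
  opposite f f≡ = ≤-reflexive (begin
    (sumL (𝟙 ∘ agree) (allBits n) + sumL f (allBits n)) * 2
      ≡⟨ cong (_* 2) (sumL-+ (𝟙 ∘ agree) f (allBits n)) ⟨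
    sumL (λ s → 𝟙 (agree s) + f s) (allBits n) * 2
      ≡⟨ cong (_* 2) (trans (sumL-cong (allBits n) f≡) (sumL-allBits-const n 1)) ⟩
    2 ^ n * 1 * 2
      ≡⟨ cong (_* 2) (*-identityʳ (2 ^ n)) ⟩
    2 ^ n * 2
      ≡⟨ *-comm (2 ^ n) 2 ⟩
    2 ^ suc n ∎)
    where open ≡-Reasoning

  cases : ∀ a b → a ∷ u ≢ b ∷ v →
    (sumL (𝟙 ∘ agree) (allBits n) + sumL (λ s → 𝟙 (does ((a xor dot s u) B.≟ (b xor dot s v)))) (allBits n)) * 2
      ≤ 2 ^ suc n
  cases false false ≢ = same _ (λ s → refl) (≢ ∘ cong (false ∷_))
  cases false true  ≢ = opposite _ (λ s → complementʳ (dot s u) (dot s v))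
  cases true  false ≢ = opposite _ (λ s → complementˡ (dot s u) (dot s v))
  cases true  true  ≢ = same _ (λ s → not-≟ (dot s u) (dot s v)) (≢ ∘ cong (true ∷_))

Hash : ℕ → ℕ → Set
Hash n m = Bits n → Bits m

-- These are the `m` × `n` matrices over the two-element field, acting on column vectors and built
-- row by row.
linearHashes : (n m : ℕ) → List (Hash n m)
linearHashes n zero    = (λ _ → []) ∷ []
linearHashes n (suc m) = cartesianProductWith (λ s h u → dot s u ∷ h u) (allBits n) (linearHashes n m)

length-linearHashes>0 : (n m : ℕ) → 0 < length (linearHashes n m)
length-linearHashes>0 n zero    = s≤s z≤n
length-linearHashes>0 n (suc m) = subst (0 <_)
  (sym (trans (length-cartesianProductWith _ (allBits n) (linearHashes n m))
              (cong (_* length (linearHashes n m)) (length-allBits n))))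
  (*-mono-≤ (m^n>0 2 n) (length-linearHashes>0 n m))

𝟙-∧ : ∀ a b → 𝟙 (a ∧ b) ≡ 𝟙 a * 𝟙 b
𝟙-∧ false b = refl
𝟙-∧ true  b = sym (+-identityʳ (𝟙 b))

-- The rows are chosen independently and each collides with probability at most one half, so the
-- probabilities multiply.
hash-collisions : (n m : ℕ) {u v : Bits n} → u ≢ v →
  sumL (λ h → 𝟙 (eqBits (h u) (h v))) (linearHashes n m) * 2 ^ m ≤ length (linearHashes n m)
hash-collisions n zero    u≢v = ≤-refl
hash-collisions n (suc m) {u} {v} u≢v = begin
  sumL (λ h → 𝟙 (eqBits (h u) (h v))) (linearHashes n (suc m)) * 2 ^ suc m
    ≡⟨ cong (_* 2 ^ suc m) (sumL-cartesianProductWith _ extend (allBits n) H) ⟩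
  sumL (λ s → sumL (λ h → 𝟙 (agree s ∧ eqBits (h u) (h v))) H) (allBits n) * 2 ^ suc m
    ≡⟨ cong (_* 2 ^ suc m) (sumL-cong (allBits n) λ s → trans
         (sumL-cong H λ h → 𝟙-∧ (agree s) (eqBits (h u) (h v)))
         (sumL-*ˡ (𝟙 (agree s)) _ H)) ⟩
  sumL (λ s → 𝟙 (agree s) * collisions) (allBits n) * 2 ^ suc m
    ≡⟨ cong (_* 2 ^ suc m) (sumL-*ʳ collisions (𝟙 ∘ agree) (allBits n)) ⟩
  sumL (𝟙 ∘ agree) (allBits n) * collisions * (2 * 2 ^ m)
    ≡⟨ interchange (sumL (𝟙 ∘ agree) (allBits n)) collisions 2 (2 ^ m) ⟩
  sumL (𝟙 ∘ agree) (allBits n) * 2 * (collisions * 2 ^ m)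
    ≤⟨ *-mono-≤ (dot-collisions u≢v) (hash-collisions n m u≢v) ⟩
  2 ^ n * length H
    ≡⟨ cong (_* length H) (length-allBits n) ⟨
  length (allBits n) * length H
    ≡⟨ length-cartesianProductWith extend (allBits n) H ⟨
  length (linearHashes n (suc m)) ∎
  where
  open ≤-Reasoning
  H = linearHashes n m
  extend : Bits n → Hash n m → Hash n (suc m)
  extend s h u = dot s u ∷ h u
  agree : Bits n → Bool
  agree s = does (dot s u B.≟ dot s v)
  collisions = sumL (λ h → 𝟙 (eqBits (h u) (h v))) H
  interchange : ∀ a b c d → a * b * (c * d) ≡ a * c * (b * d)
  interchange = solve-∀

-- Equal strings cannot be confused, so the collision bound extends to all pairs and can be used
-- without knowing whether the probed prefixes differ.
false-positives : (n m : ℕ) (u v : Bits n) →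
  sumL (λ h → 𝟙 (not (eqBits u v) ∧ eqBits (h u) (h v))) (linearHashes n m) * 2 ^ m ≤ length (linearHashes n m)
false-positives n m u v with eqBits u v in eq
... | false = hash-collisions n m (eqBits-false⇒≢ u v eq)
... | true
  rewrite sumL-const 0 (linearHashes n m) | *-zeroʳ (length (linearHashes n m)) = z≤n

-- Derandomization

module Run {A H S : Set} (next : A → H → S → S) (fails : A → H → S → Bool) where

  walk : {L : ℕ} → A → Vec H L → S → S
  walk a []       σ = σ
  walk a (h ∷ hs) σ = walk a hs (next a h σ)

  failures : {L : ℕ} → A → Vec H L → S → ℕ
  failures a []       σ = 0
  failures a (h ∷ hs) σ = 𝟙 (fails a h σ) + failures a hs (next a h σ)

-- Hashes are fixed one at a time, each keeping the potential Σ_a 2^(m · failures so far) within a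
-- factor 2 of its previous value; a suitable hash exists because that holds on average.
module Greedy {A H S : Set} (inputs : List A) (hashes : List H) (m : ℕ)
  (next : A → H → S → S) (fails : A → H → S → Bool)
  (nonempty : 0 < length hashes)
  (rare : ∀ a σ → sumL (λ h → 𝟙 (fails a h σ)) hashes * 2 ^ m ≤ length hashes)
  where

  open Run next fails

  -- For each input the new factor is `2 ^ m` on a fraction of at most `1 / 2 ^ m` of the hashes and
  -- 1 on the others, so its mean is at most 2. Each input has its own state `σ a`, settled by the
  -- hashes already fixed.
  greedy-step : (w : A → ℕ) (σ : A → S) →
    ∃[ h ] sumL (λ a → w a * 2 ^ (m * 𝟙 (fails a h (σ a)))) inputs ≤ 2 * sumL w inputs
  greedy-step w σ = sumL-≤-average hashes nonempty (begin
    sumL (λ h → sumL (λ a → w a * 2 ^ (m * F a h)) inputs) hashes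
      ≡⟨ sumL-swap _ hashes inputs ⟩
    sumL (λ a → sumL (λ h → w a * 2 ^ (m * F a h)) hashes) inputs
      ≡⟨ sumL-cong inputs (λ a → sumL-*ˡ (w a) _ hashes) ⟩
    sumL (λ a → w a * sumL (λ h → 2 ^ (m * F a h)) hashes) inputs
      ≤⟨ sumL-mono inputs (λ a → *-monoʳ-≤ (w a) (mean a)) ⟩
    sumL (λ a → w a * (length hashes * 2)) inputs
      ≡⟨ sumL-*ʳ (length hashes * 2) w inputs ⟩
    sumL w inputs * (length hashes * 2)
      ≡⟨ rotate (sumL w inputs) (length hashes) 2 ⟩
    length hashes * (2 * sumL w inputs) ∎)
    where
    open ≤-Reasoning
    F : A → H → ℕ
    F a h = 𝟙 (fails a h (σ a))
    rotate : ∀ a b c → a * (b * c) ≡ b * (c * a)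
    rotate = solve-∀
    linearize : ∀ b → 2 ^ (m * 𝟙 b) ≤ 1 + 𝟙 b * 2 ^ m
    linearize false rewrite *-zeroʳ m = ≤-refl
    linearize true  rewrite *-identityʳ m | +-identityʳ (2 ^ m) = n≤1+n _
    mean : ∀ a → sumL (λ h → 2 ^ (m * F a h)) hashes ≤ length hashes * 2
    mean a = begin
      sumL (λ h → 2 ^ (m * F a h)) hashes
        ≤⟨ sumL-mono hashes (λ h → linearize (fails a h (σ a))) ⟩
      sumL (λ h → 1 + F a h * 2 ^ m) hashes
        ≡⟨ sumL-+ (λ _ → 1) (λ h → F a h * 2 ^ m) hashes ⟩
      sumL (λ _ → 1) hashes + sumL (λ h → F a h * 2 ^ m) hashes
        ≡⟨ cong₂ _+_ (sumL-const 1 hashes) (sumL-*ʳ (2 ^ m) (F a) hashes) ⟩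
      length hashes * 1 + sumL (F a) hashes * 2 ^ m
        ≤⟨ +-monoʳ-≤ (length hashes * 1) (rare a (σ a)) ⟩
      length hashes * 1 + length hashes
        ≡⟨ double (length hashes) ⟩
      length hashes * 2 ∎
      where
      double : ∀ l → l * 1 + l ≡ l * 2
      double = solve-∀

  potential-split : (w : A → ℕ) (f g : A → ℕ) →
    sumL (λ a → w a * 2 ^ (m * (f a + g a))) inputs ≡ sumL (λ a → w a * 2 ^ (m * f a) * 2 ^ (m * g a)) inputs
  potential-split w f g = sumL-cong inputs λ a → begin
    w a * 2 ^ (m * (f a + g a))              ≡⟨ cong (λ e → w a * 2 ^ e) (*-distribˡ-+ m (f a) (g a)) ⟩
    w a * 2 ^ (m * f a + m * g a)            ≡⟨ cong (w a *_) (^-distribˡ-+-* 2 (m * f a) (m * g a)) ⟩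
    w a * (2 ^ (m * f a) * 2 ^ (m * g a))    ≡⟨ *-assoc (w a) _ _ ⟨
    w a * 2 ^ (m * f a) * 2 ^ (m * g a)      ∎
    where open ≡-Reasoning

  potential-0 : (w : A → ℕ) → sumL (λ a → w a * 2 ^ (m * 0)) inputs ≡ sumL w inputs
  potential-0 w = sumL-cong inputs λ a → trans (cong (λ e → w a * 2 ^ e) (*-zeroʳ m)) (*-identityʳ (w a))

  -- The weights are arbitrary so that the factors earned by the first hash can be absorbed into
  -- them before the remaining hashes are chosen.
  greedy-sequence : (L : ℕ) (w : A → ℕ) (σ : A → S) → ∃[ hs ]
    sumL (λ a → w a * 2 ^ (m * failures {L} a hs (σ a))) inputs ≤ 2 ^ L * sumL w inputs
  greedy-sequence zero    w σ = [] , ≤-reflexive (trans (potential-0 w) (sym (+-identityʳ _)))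
  greedy-sequence (suc L) w σ =
    let h  , step≤ = greedy-step w σ
        w′ = λ a → w a * 2 ^ (m * 𝟙 (fails a h (σ a)))
        hs , rest≤ = greedy-sequence L w′ (λ a → next a h (σ a))
    in h ∷ hs , (begin
      sumL (λ a → w a * 2 ^ (m * failures a (h ∷ hs) (σ a))) inputs
        ≡⟨ potential-split w _ _ ⟩
      sumL (λ a → w′ a * 2 ^ (m * failures a hs (next a h (σ a)))) inputs
        ≤⟨ rest≤ ⟩
      2 ^ L * sumL w′ inputs
        ≤⟨ *-monoʳ-≤ (2 ^ L) step≤ ⟩
      2 ^ L * (2 * sumL w inputs)
        ≡⟨ rotate (2 ^ L) 2 (sumL w inputs) ⟩
      2 ^ suc L * sumL w inputs ∎)
    where
    open ≤-Reasoning
    rotate : ∀ a b c → a * (b * c) ≡ b * a * c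
    rotate = solve-∀

  -- Every run restarts from `σ`, but the potential is carried over: the second half of the table is
  -- chosen with weights that record the failures in the first half.
  greedy-table : (k L : ℕ) (w : A → ℕ) (σ : S) → ∃[ table ]
    sumL (λ a → w a * 2 ^ (m * sumL (λ i → failures {L} a (table i) σ) (allBits k))) inputs
      ≤ 2 ^ (2 ^ k * L) * sumL w inputs
  greedy-table zero L w σ = let hs , hs≤ = greedy-sequence L w (λ _ → σ) in (λ _ → hs) , (begin
    sumL (λ a → w a * 2 ^ (m * (failures a hs σ + 0))) inputs
      ≡⟨ sumL-cong inputs (λ a → cong (λ e → w a * 2 ^ (m * e)) (+-identityʳ (failures a hs σ))) ⟩
    sumL (λ a → w a * 2 ^ (m * failures a hs σ)) inputs
      ≤⟨ hs≤ ⟩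
    2 ^ L * sumL w inputs
      ≡⟨ cong (λ e → 2 ^ e * sumL w inputs) (+-identityʳ L) ⟨
    2 ^ (1 * L) * sumL w inputs ∎)
    where open ≤-Reasoning
  greedy-table (suc k) L w σ =
    let t₀ , t₀≤ = greedy-table k L w σ
        f₀ = λ a → sumL (λ i → failures a (t₀ i) σ) (allBits k)
        w′ = λ a → w a * 2 ^ (m * f₀ a)
        t₁ , t₁≤ = greedy-table k L w′ σ
        f₁ = λ a → sumL (λ i → failures a (t₁ i) σ) (allBits k)
    in join t₀ t₁ , (begin
      sumL (λ a → w a * 2 ^ (m * sumL (λ i → failures a (join t₀ t₁ i) σ) (allBits (suc k)))) inputs
        ≡⟨ sumL-cong inputs (λ a → cong (λ e → w a * 2 ^ (m * e))
             (sumL-allBits k (λ i → failures a (join t₀ t₁ i) σ))) ⟩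
      sumL (λ a → w a * 2 ^ (m * (f₀ a + f₁ a))) inputs
        ≡⟨ potential-split w f₀ f₁ ⟩
      sumL (λ a → w′ a * 2 ^ (m * f₁ a)) inputs
        ≤⟨ t₁≤ ⟩
      2 ^ (2 ^ k * L) * sumL w′ inputs
        ≤⟨ *-monoʳ-≤ (2 ^ (2 ^ k * L)) t₀≤ ⟩
      2 ^ (2 ^ k * L) * (2 ^ (2 ^ k * L) * sumL w inputs)
        ≡⟨ *-assoc (2 ^ (2 ^ k * L)) _ _ ⟨
      2 ^ (2 ^ k * L) * 2 ^ (2 ^ k * L) * sumL w inputs
        ≡⟨ cong (_* sumL w inputs) (^-distribˡ-+-* 2 (2 ^ k * L) (2 ^ k * L)) ⟨
      2 ^ (2 ^ k * L + 2 ^ k * L) * sumL w inputs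
        ≡⟨ cong (λ e → 2 ^ e * sumL w inputs) (double (2 ^ k) L) ⟩
      2 ^ (2 ^ suc k * L) * sumL w inputs ∎)
    where
    open ≤-Reasoning
    join : {B : Set} → (Bits k → B) → (Bits k → B) → Bits (suc k) → B
    join t₀ t₁ (false ∷ i) = t₀ i
    join t₀ t₁ (true  ∷ i) = t₁ i
    double : ∀ a b → a * b + a * b ≡ 2 * a * b
    double = solve-∀

  -- With unit weights the potential starts at the number of inputs. The term of a single input is
  -- bounded by the final sum, and comparing exponents of 2 bounds its failures.
  few-failures : (k L e : ℕ) (σ : S) → length inputs ≤ 2 ^ e → ∃[ table ] (∀ {a} → a ∈ inputs →
    m * sumL (λ i → failures {L} a (table i) σ) (allBits k) ≤ 2 ^ k * L + e)
  few-failures k L e σ #inputs≤ =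
    let table , table≤ = greedy-table k L (λ _ → 1) σ
    in table , λ {a} a∈ → 2^-cancel-≤ (begin
      2 ^ (m * sumL (λ i → failures a (table i) σ) (allBits k))
        ≡⟨ +-identityʳ _ ⟨
      1 * 2 ^ (m * sumL (λ i → failures a (table i) σ) (allBits k))
        ≤⟨ sumL-∈ (λ a → 1 * 2 ^ (m * sumL (λ i → failures a (table i) σ) (allBits k))) a∈ ⟩
      sumL (λ a → 1 * 2 ^ (m * sumL (λ i → failures a (table i) σ) (allBits k))) inputs
        ≤⟨ table≤ ⟩
      2 ^ (2 ^ k * L) * sumL (λ _ → 1) inputs
        ≡⟨ cong (2 ^ (2 ^ k * L) *_) (trans (sumL-const 1 inputs) (*-identityʳ _)) ⟩
      2 ^ (2 ^ k * L) * length inputs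
        ≤⟨ *-monoʳ-≤ (2 ^ (2 ^ k * L)) #inputs≤ ⟩
      2 ^ (2 ^ k * L) * 2 ^ e
        ≡⟨ ^-distribˡ-+-* 2 (2 ^ k * L) e ⟨
      2 ^ (2 ^ k * L + e) ∎)
    where
    open ≤-Reasoning
    2^-cancel-≤ : ∀ {x y} → 2 ^ x ≤ 2 ^ y → x ≤ y
    2^-cancel-≤ 2^x≤2^y = ≮⇒≥ λ y<x → <⇒≱ (^-monoʳ-< 2 (s≤s (s≤s z≤n)) y<x) 2^x≤2^y

-- Prefixes and comparison

-- The first i bits, padded with zeros to the original length.
prefix : {n : ℕ} → ℕ → Bits n → Bits n
prefix i       []      = []
prefix zero    (_ ∷ u) = false ∷ prefix zero u
prefix (suc i) (b ∷ u) = b ∷ prefix i u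

bitAt : {n : ℕ} → Bits n → ℕ → Bool
bitAt []      _       = false
bitAt (b ∷ u) zero    = b
bitAt (b ∷ u) (suc i) = bitAt u i

prefix-zero : {n : ℕ} (u v : Bits n) → prefix 0 u ≡ prefix 0 v
prefix-zero []      []      = refl
prefix-zero (_ ∷ u) (_ ∷ v) = cong (false ∷_) (prefix-zero u v)

prefix-shorten : {n : ℕ} (i c : ℕ) (u v : Bits n) → prefix (i + c) u ≡ prefix (i + c) v → prefix i u ≡ prefix i v
prefix-shorten i       c []      []      _ = refl
prefix-shorten zero    c u       v       _ = prefix-zero u v
prefix-shorten (suc i) c (a ∷ u) (b ∷ v) e with ∷-injective e
... | a≡b , e′ = cong₂ _∷_ a≡b (prefix-shorten i c u v e′)

prefix-full : {n i : ℕ} → n ≤ i → (u : Bits n) → prefix i u ≡ u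
prefix-full _         []      = refl
prefix-full (s≤s n≤i) (b ∷ u) = cong (b ∷_) (prefix-full n≤i u)

≤⇒≤ᵇ≡true : {m n : ℕ} → m ≤ n → (m ≤ᵇ n) ≡ true
≤⇒≤ᵇ≡true {m} {n} m≤n with m ≤ᵇ n | ≤⇒≤ᵇ m≤n
... | true | _ = refl

>⇒≤ᵇ≡false : {m n : ℕ} → n < m → (m ≤ᵇ n) ≡ false
>⇒≤ᵇ≡false {m} {n} n<m with m ≤ᵇ n | ≤ᵇ⇒≤ m n
... | false | _    = refl
... | true  | m≤n = contradiction (m≤n _) (<⇒≱ n<m)

+-cancelˡ-≤ᵇ : (c m n : ℕ) → (c + m ≤ᵇ c + n) ≡ (m ≤ᵇ n)
+-cancelˡ-≤ᵇ zero    m n = refl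
+-cancelˡ-≤ᵇ (suc c) m n = trans (suc-≤ᵇ (c + m) (c + n)) (+-cancelˡ-≤ᵇ c m n)
  where
  suc-≤ᵇ : ∀ m n → (suc m ≤ᵇ suc n) ≡ (m ≤ᵇ n)
  suc-≤ᵇ zero    n = refl
  suc-≤ᵇ (suc m) n = refl

-- The sentinels make the strings differ even if x ≡ y, and break that tie in favour of x.
first-difference : {n : ℕ} (x y : Bits n) (i : ℕ) →
  prefix i (x ∷ʳ true) ≡ prefix i (y ∷ʳ false) →
  prefix (suc i) (x ∷ʳ true) ≢ prefix (suc i) (y ∷ʳ false) →
  bitAt (x ∷ʳ true) i ≡ (val y ≤ᵇ val x)
first-difference []          []          zero    _ _ = refl
first-difference []          []          (suc i) () _
first-difference (false ∷ x) (false ∷ y) zero    _ ≢ = contradiction (cong (false ∷_) (prefix-zero _ _)) ≢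
first-difference (true ∷ x)  (true ∷ y)  zero    _ ≢ = contradiction (cong (true ∷_) (prefix-zero _ _)) ≢
first-difference {suc n} (false ∷ x) (true ∷ y) zero _ _ =
  sym (>⇒≤ᵇ≡false (≤-trans (val<2^n x) (m≤m+n (2 ^ n) (val y))))
first-difference {suc n} (true ∷ x) (false ∷ y) zero _ _ =
  sym (≤⇒≤ᵇ≡true (≤-trans (<⇒≤ (val<2^n y)) (m≤m+n (2 ^ n) (val x))))
first-difference {suc n} (a ∷ x) (b ∷ y) (suc i) ≡ᵢ ≢ᵢ with ∷-injective ≡ᵢ
-- A common head adds the same amount to both values.
... | refl , ≡ᵢ′ = trans (first-difference x y i ≡ᵢ′ (≢ᵢ ∘ cong (a ∷_)))
  (sym (+-cancelˡ-≤ᵇ (if a then 2 ^ n else 0) (val y) (val x)))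

-- Noisy binary search with backtracking

-- A node at level j of the search tree stands for the interval [lo , lo + 2^j).
data Path (d : ℕ) : ℕ → Set where
  root  : Path d d
  child : {j : ℕ} → Bool → Path d (suc j) → Path d j

Node : ℕ → Set
Node d = ∃[ j ] Path d j

lo : {d j : ℕ} → Path d j → ℕ
lo root                = 0
lo {j = j} (child b p) = lo p + (if b then 2 ^ j else 0)

start : {d : ℕ} → Node d → ℕ
start (_ , p) = lo p

middle : {d : ℕ} → Node d → ℕ
-- A default value: a leaf has no middle, and with this choice a leaf whose start agrees cannot
-- fail.
middle (zero  , p) = lo p
middle (suc j , p) = lo p + 2 ^ j

parent : {d j : ℕ} → Path d j → Node d
-- A default value: the empty prefixes at the start of the root always agree, so the search never
-- backtracks from there.
parent root        = _ , root
parent (child _ p) = _ , p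

advance : {d : ℕ} → Node d → (startAgrees middleAgrees : Bool) → Node d
advance (_     , p) false _ = parent p
advance (zero  , p) true  _ = _ , p
advance (suc _ , p) true  b = _ , child b p

module Search (N m d : ℕ) where

  Input : Set
  Input = Bits N × Bits N

  agree : Input → ℕ → Bool
  agree (u , v) i = eqBits (prefix i u) (prefix i v)

  probe : Input → Hash N m → ℕ → Bool
  probe (u , v) h i = eqBits (h (prefix i u)) (h (prefix i v))

  next : Input → Hash N m → Node d → Node d
  next a h σ = advance σ (probe a h (start σ)) (probe a h (middle σ))

  -- The only probe whose outcome matters: a wrong node must detect its own wrongness.
  critical : Input → Node d → ℕ
  critical a σ = if agree a (start σ) then middle σ else start σ

  fails : Input → Hash N m → Node d → Bool
  fails a h σ = not (agree a (critical a σ)) ∧ probe a h (critical a σ)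

  rare : ∀ a σ → sumL (λ h → 𝟙 (fails a h σ)) (linearHashes N m) * 2 ^ m ≤ length (linearHashes N m)
  rare a@(u , v) σ = false-positives N m (prefix (critical a σ) u) (prefix (critical a σ) v)

  open Run next fails public

  -- Errors are one-sided: equal prefixes have equal hashes, so a failure is always a false
  -- agreement.
  probe-complete : ∀ a h i → agree a i ≡ true → probe a h i ≡ true
  probe-complete (u , v) h i e
    rewrite eqBits-true⇒≡ (prefix i u) (prefix i v) e = eqBits-refl (h (prefix i v))

  agree-mono : ∀ a i c → agree a i ≡ false → agree a (i + c) ≡ false
  agree-mono (u , v) i c e with agree (u , v) (i + c) in e′
  ... | false = refl
  ... | true  = contradiction
    (prefix-shorten i c u v (eqBits-true⇒≡ (prefix (i + c) u) (prefix (i + c) v) e′))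
    (eqBits-false⇒≢ (prefix i u) (prefix i v) e)

  data Found (a : Input) : Node d → Set where
    found : {p : Path d 0} → agree a (lo p) ≡ true → agree a (lo p + 1) ≡ false → Found a (0 , p)

  -- The index is j + 2w for a node at level j with w wrong intervals on top of the correct ones,
  -- i.e. the number of error-free steps still needed to reach the correct leaf.
  data Deficit (a : Input) : Node d → ℕ → Set where
    on  : {j : ℕ} {p : Path d j} → agree a (lo p) ≡ true → agree a (lo p + 2 ^ j) ≡ false →
          Deficit a (j , p) j
    off : {j ψ : ℕ} {b : Bool} {p : Path d (suc j)} → Deficit a (suc j , p) ψ →
          agree a (lo (child b p)) ≡ false → Deficit a (j , child b p) (suc ψ)

  -- Without a failure the deficit drops by at least 1; with one it grows by at most 1. The
  -- coefficient 2 is the difference.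
  Progress : Input → Hash N m → Node d → ℕ → Set
  Progress a h σ ψ = ∃[ ψ′ ] Deficit a (next a h σ) ψ′ × suc ψ′ ≤ ψ + 2 * 𝟙 (fails a h σ)

  step-on : ∀ a h {j} (p : Path d (suc j)) → agree a (lo p) ≡ true → agree a (lo p + 2 ^ suc j) ≡ false →
    Progress a h (suc j , p) (suc j)
  step-on a h {j} p start≡ end≡
    rewrite probe-complete a h (lo p) start≡ | start≡
    with agree a (lo p + 2 ^ j) in middle≡ | probe a h (lo p + 2 ^ j) in probe≡
  ... | true  | true  = j , on middle≡ (subst (λ i → agree a i ≡ false) (halves (lo p) (2 ^ j)) end≡) , m≤m+n _ 0
    where
    halves : ∀ l x → l + 2 * x ≡ l + x + x
    halves = solve-∀
  ... | true  | false with () ← trans (sym probe≡) (probe-complete a h (lo p + 2 ^ j) middle≡)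
  -- False agreement at the middle: the search enters the wrong right half, one step to undo on top
  -- of the `suc j` still needed.
  ... | false | true  = suc (suc j) , off (on start≡ end≡) middle≡ , ≤-reflexive (+-comm 2 (suc j))
  ... | false | false = j ,
    on (subst (λ i → agree a i ≡ true) (sym (+-identityʳ (lo p))) start≡)
       (subst (λ i → agree a (i + 2 ^ j) ≡ false) (sym (+-identityʳ (lo p))) middle≡) ,
    m≤m+n _ 0

  step-off : ∀ a h {j ψ b} {p : Path d (suc j)} → Deficit a (suc j , p) ψ →
    agree a (lo (child b p)) ≡ false → Progress a h (j , child b p) (suc ψ)
  step-off a h {j} {ψ} {b} {p} D start≡
    -- The first rewrite evaluates the critical index to the start, the second the agreement there.
    rewrite start≡ | start≡ with probe a h (lo (child b p))
  ... | false = ψ , D , m≤m+n _ 0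
  step-off a h {zero} {ψ} {b} {p} D start≡ | true = suc ψ , off D start≡ , s≤s (≤-trans (n≤1+n (suc ψ)) (≤-reflexive (+-comm 2 ψ)))
  -- The wrong start went unnoticed. Whichever child is entered begins no earlier, so it is off as
  -- well.
  step-off a h {suc j} {ψ} {b} {p} D start≡ | true =
    suc (suc ψ) ,
    off (off D start≡) (agree-mono a (lo (child b p)) _ start≡) ,
    ≤-reflexive (+-comm 2 (suc ψ))

  step : ∀ a h {σ ψ} → Deficit a σ ψ → Found a σ ⊎ Progress a h σ ψ
  step a h {zero  , p} (on start≡ end≡) = inj₁ (found start≡ end≡)
  step a h {suc j , p} (on start≡ end≡) = inj₂ (step-on a h p start≡ end≡)
  step a h             (off D start≡)   = inj₂ (step-off a h D start≡)

  -- A correct leaf is absorbing: its start agrees, so no hash can trigger backtracking, and there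
  -- is nowhere to descend.
  found-stable : ∀ {L} a (hs : Vec (Hash N m) L) {σ} → Found a σ → Found a (walk a hs σ)
  found-stable a []       F = F
  found-stable a (h ∷ hs) F@(found {p} start≡ end≡)
    rewrite probe-complete a h (lo p) start≡ = found-stable a hs F

  -- The bounds of `Progress` telescope along the run. A run that ends elsewhere than at the correct
  -- leaf still has a positive deficit, whence the strict inequality.
  found-or-failures : ∀ {L} a (hs : Vec (Hash N m) L) {σ ψ} → Deficit a σ ψ →
    Found a (walk a hs σ) ⊎ L < ψ + 2 * failures a hs σ
  found-or-failures a [] {zero , _}  (on start≡ end≡) = inj₁ (found start≡ end≡)
  found-or-failures a [] {suc _ , _} (on _ _)         = inj₂ (s≤s z≤n)
  found-or-failures a [] (off _ _)                    = inj₂ (s≤s z≤n)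
  found-or-failures {suc L} a (h ∷ hs) {σ} {ψ} D with step a h D
  ... | inj₁ F = inj₁ (found-stable a (h ∷ hs) F)
  ... | inj₂ (ψ′ , D′ , ψ′<) with found-or-failures a hs D′
  ...   | inj₁ F = inj₁ F
  ...   | inj₂ L< = inj₂ (begin-strict
    suc L                                                      <⟨ s≤s L< ⟩
    suc ψ′ + 2 * failures a hs (next a h σ)                    ≤⟨ +-monoˡ-≤ _ ψ′< ⟩
    ψ + 2 * 𝟙 (fails a h σ) + 2 * failures a hs (next a h σ)   ≡⟨ regroup ψ (𝟙 (fails a h σ)) _ ⟩
    ψ + 2 * failures a (h ∷ hs) σ                              ∎)
    where
    open ≤-Reasoning
    regroup : ∀ x y z → x + 2 * y + 2 * z ≡ x + 2 * (y + z)
    regroup = solve-∀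

-- Protocol trees with labelled leaves

data Dialogue (VA VB R : Set) : ℕ → Set where
  ret  : R → Dialogue VA VB R 0
  askA : {c : ℕ} → (VA → Bool) → (Bool → Dialogue VA VB R c) → Dialogue VA VB R (suc c)
  askB : {c : ℕ} → (VB → Bool) → (Bool → Dialogue VA VB R c) → Dialogue VA VB R (suc c)

module _ {VA VB : Set} where

  exec : {R : Set} {c : ℕ} → Dialogue VA VB R c → VA → VB → R
  exec (ret r)    a b = r
  exec (askA f k) a b = exec (k (f a)) a b
  exec (askB f k) a b = exec (k (f b)) a b

  erase : {R : Set} {c : ℕ} → Dialogue VA VB R c → Protocol VA VB
  erase (ret _)    = done
  erase (askA f k) = sendA f (erase ∘ k)
  erase (askB f k) = sendB f (erase ∘ k)

  -- On a transcript that is too short the missing bits are read as false.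
  decode : {R : Set} {c : ℕ} → Dialogue VA VB R c → List Bool → R
  decode (ret r)    _       = r
  decode (askA f k) []      = decode (k false) []
  decode (askA f k) (b ∷ t) = decode (k b) t
  decode (askB f k) []      = decode (k false) []
  decode (askB f k) (b ∷ t) = decode (k b) t

  -- The result at the leaf is thus known to both parties from the transcript alone, as the output
  -- maps require.
  decode-transcript : {R : Set} {c : ℕ} (D : Dialogue VA VB R c) (a : VA) (b : VB) →
    decode D (transcript (erase D) a b) ≡ exec D a b
  decode-transcript (ret r)    a b = refl
  decode-transcript (askA f k) a b = decode-transcript (k (f a)) a b
  decode-transcript (askB f k) a b = decode-transcript (k (f b)) a b

  depth-erase : {R : Set} {c : ℕ} (D : Dialogue VA VB R c) → depth (erase D) ≡ c
  depth-erase (ret r)    = refl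
  depth-erase {c = suc c} (askA f k) rewrite depth-erase (k false) | depth-erase (k true) = cong suc (⊔-idem c)
  depth-erase {c = suc c} (askB f k) rewrite depth-erase (k false) | depth-erase (k true) = cong suc (⊔-idem c)

  sendBitsA : {R : Set} {c : ℕ} (j : ℕ) → (VA → Bits j) → (Bits j → Dialogue VA VB R c) → Dialogue VA VB R (j + c)
  sendBitsA zero    f k = k []
  sendBitsA (suc j) f k = askA (head ∘ f) λ b → sendBitsA j (tail ∘ f) (k ∘ (b ∷_))

  exec-sendBitsA : {R : Set} {c : ℕ} (j : ℕ) (f : VA → Bits j) (k : Bits j → Dialogue VA VB R c) (a : VA) (b : VB) →
    exec (sendBitsA j f k) a b ≡ exec (k (f a)) a b
  exec-sendBitsA zero    f k a b with f a
  ... | [] = refl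
  exec-sendBitsA (suc j) f k a b =
    trans (exec-sendBitsA j (tail ∘ f) (k ∘ (head (f a) ∷_)) a b) (cong (λ w → exec (k w) a b) (η (f a)))
    where
    η : (w : Bits (suc j)) → head w ∷ tail w ≡ w
    η (_ ∷ _) = refl

-- The recursion mirrors `searchDialogue`, whose index it is. A step makes two probes, each of `m`
-- hash bits from Alice and one reply from Bob.
searchCost : (m L c : ℕ) → ℕ
searchCost m zero    c = c
searchCost m (suc L) c = m + suc (m + suc (searchCost m L c))

searchCost-linear : (m L c : ℕ) → searchCost m L c ≡ L * (2 * suc m) + c
searchCost-linear m zero    c = refl
searchCost-linear m (suc L) c rewrite searchCost-linear m L c = regroup m (L * (2 * suc m)) c
  where
  regroup : ∀ m x c → m + suc (m + suc (x + c)) ≡ 2 * suc m + x + c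
  regroup = solve-∀

module SearchDialogue {VA VB : Set} (N m d : ℕ) (inA : VA → Bits N) (inB : VB → Bits N) where
  open Search N m d

  probeDialogue : {R : Set} {c : ℕ} → Hash N m → ℕ → (Bool → Dialogue VA VB R c) → Dialogue VA VB R (m + suc c)
  probeDialogue h i k = sendBitsA m (h ∘ prefix i ∘ inA) λ w → askB (λ b → eqBits w (h (prefix i (inB b)))) k

  exec-probeDialogue : {R : Set} {c : ℕ} (h : Hash N m) (i : ℕ) (k : Bool → Dialogue VA VB R c) (a : VA) (b : VB) →
    exec (probeDialogue h i k) a b ≡ exec (k (probe (inA a , inB b) h i)) a b
  exec-probeDialogue h i k a b = exec-sendBitsA m _ _ a b

  searchDialogue : {R : Set} {L c : ℕ} → Vec (Hash N m) L → Node d → (Node d → Dialogue VA VB R c) →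
    Dialogue VA VB R (searchCost m L c)
  searchDialogue []       σ k = k σ
  searchDialogue (h ∷ hs) σ k =
    -- Both probes are made at every node, even where `advance` ignores the second, so that all
    -- branches have the same depth. Both parties see the replies and can follow the node.
    probeDialogue h (start σ) λ b₁ → probeDialogue h (middle σ) λ b₂ → searchDialogue hs (advance σ b₁ b₂) k

  exec-searchDialogue : {R : Set} {L c : ℕ} (hs : Vec (Hash N m) L) (σ : Node d) (k : Node d → Dialogue VA VB R c)
    (a : VA) (b : VB) → exec (searchDialogue hs σ k) a b ≡ exec (k (walk (inA a , inB b) hs σ)) a b
  exec-searchDialogue []       σ k a b = refl
  exec-searchDialogue (h ∷ hs) σ k a b =
    trans (exec-probeDialogue h (start σ) _ a b)
      (trans (exec-probeDialogue h (middle σ) _ a b)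
        (exec-searchDialogue hs (next (inA a , inB b) h σ) k a b))

-- Upper bound

n≤2^⌈log₂n⌉ : (n : ℕ) → n ≤ 2 ^ ⌈log₂ n ⌉
n≤2^⌈log₂n⌉ n = bound n (<-wellFounded n)
  where
  n≤2⌈n/2⌉ : ∀ n → n ≤ 2 * ⌈ n /2⌉
  n≤2⌈n/2⌉ n = begin
    n                        ≡⟨ ⌊n/2⌋+⌈n/2⌉≡n n ⟨
    ⌊ n /2⌋ + ⌈ n /2⌉        ≤⟨ +-monoˡ-≤ ⌈ n /2⌉ (⌊n/2⌋≤⌈n/2⌉ n) ⟩
    ⌈ n /2⌉ + ⌈ n /2⌉        ≡⟨ cong (⌈ n /2⌉ +_) (+-identityʳ ⌈ n /2⌉) ⟨
    2 * ⌈ n /2⌉              ∎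
    where open ≤-Reasoning
  bound : ∀ n (rec : Acc _<_ n) → n ≤ 2 ^ ⌈log2⌉ n rec
  bound 0             _        = z≤n
  bound 1             _        = ≤-refl
  bound (suc (suc n)) (acc rs) =
    ≤-trans (n≤2⌈n/2⌉ (suc (suc n))) (*-monoʳ-≤ 2 (bound (suc ⌈ n /2⌉) _))

winnerOutputA winnerOutputB : {n : ℕ} → Bool → Bits n → OutT n
winnerOutputA w x = if w then just x else nothing
winnerOutputB w y = if w then nothing else just y

winner-good : {n : ℕ} (x y : Bits n) (w : Bool) → w ≡ (val y ≤ᵇ val x) →
  oot-good n (winnerOutputA w x , winnerOutputB w y) x y ≡ true
winner-good x y w refl with val y ≤ᵇ val x
... | true  rewrite eqBits-refl x = refl
... | false rewrite eqBits-refl y = refl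

module MaxProtocol (n k d m L : ℕ) (table : Bits k → Vec (Hash (suc n) m) L) where

  VA = Bits n × Bits k
  VB = Bits n × Bits 0

  open SearchDialogue {VA} {VB} (suc n) m d (λ a → proj₁ a ∷ʳ true) (λ b → proj₁ b ∷ʳ false)
  open Search (suc n) m d

  winnerDialogue : Dialogue VA VB Bool (k + searchCost m L 1)
  winnerDialogue = sendBitsA k proj₂ λ i →
    -- At the first difference Alice's bit tells whether `x` wins; sending it settles for both
    -- parties who outputs.
    searchDialogue (table i) (d , root) λ σ → askA (λ a → bitAt (proj₁ a ∷ʳ true) (start σ)) ret

  protocol : RProtocol n (OutT n) (OutT n)
  protocol = record
    { kp = 0 ; ka = k ; kb = 0
    ; tree = λ _ → erase winnerDialogue
    ; outA = λ t _ _ x → winnerOutputA (decode winnerDialogue t) x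
    ; outB = λ t _ _ y → winnerOutputB (decode winnerDialogue t) y
    }

  good : Bits n → Bits n → Bits k → Bool
  good x y i = oot-good n (run protocol x y [] i []) x y

  found⇒good : (x y : Bits n) (i : Bits k) →
    Found (x ∷ʳ true , y ∷ʳ false) (walk (x ∷ʳ true , y ∷ʳ false) (table i) (d , root)) → good x y i ≡ true
  found⇒good x y i F = winner-good x y _ (begin
    decode winnerDialogue (transcript (erase winnerDialogue) (x , i) (y , []))
      ≡⟨ decode-transcript winnerDialogue (x , i) (y , []) ⟩
    exec winnerDialogue (x , i) (y , [])
      ≡⟨ exec-sendBitsA k proj₂ _ (x , i) (y , []) ⟩
    exec (searchDialogue (table i) (d , root) λ σ → askA (λ a → bitAt (proj₁ a ∷ʳ true) (start σ)) ret) (x , i) (y , [])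
      ≡⟨ exec-searchDialogue (table i) (d , root) _ (x , i) (y , []) ⟩
    bitAt (x ∷ʳ true) (start (walk (x ∷ʳ true , y ∷ʳ false) (table i) (d , root)))
      ≡⟨ leaf F ⟩
    (val y ≤ᵇ val x) ∎)
    where
    open ≡-Reasoning
    leaf : ∀ {σ} → Found (x ∷ʳ true , y ∷ʳ false) σ → bitAt (x ∷ʳ true) (start σ) ≡ (val y ≤ᵇ val x)
    leaf (found {p} agree≡ differ≡) = first-difference x y (lo p)
      (eqBits-true⇒≡ _ _ agree≡)
      (subst (λ i → prefix i (x ∷ʳ true) ≢ prefix i (y ∷ʳ false)) (+-comm (lo p) 1) (eqBits-false⇒≢ _ _ differ≡))

  goodCount≡ : (x y : Bits n) →
    goodCount protocol (λ o → oot-good n o x y) x y ≡ sumL (𝟙 ∘ good x y) (allBits k)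
  goodCount≡ x y = trans (+-identityʳ _) (sumL-cong (allBits k) λ i → +-identityʳ _)

∷ʳ-≢ : {n : ℕ} (x y : Bits n) → x ∷ʳ true ≢ y ∷ʳ false
∷ʳ-≢ []      []      ()
∷ʳ-≢ (a ∷ x) (b ∷ y) e = ∷ʳ-≢ x y (proj₂ (∷-injective e))

ootpriv-upper-bound : (p q n k : ℕ) → 0 < p → p ≤ q → n ≤ 2 ^ k →
  OOTpriv≤ p q n ((6 * suc (3 * q) + 1) * k + (6 * suc (3 * q) + 1))
ootpriv-upper-bound p q n k 0<p p≤q n≤2^k = protocol , refl , cost≤ , error≤
  where
  -- Then `2 ^ d` is at least `suc n`, the length with the sentinel.
  d = suc k
  -- With this `m` the bound `K * L + 2n ≤ 3 * K * suc d` on `m * F` leaves an average of at most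
  -- `suc d / q` failures per run.
  m = 3 * q
  -- A run missing the leaf satisfies `3 * d < d + 2 * #fail i`, so it has more than `d` failures.
  L = 3 * d

  open Search (suc n) m d

  sentinels : Bits n → Bits n → Input
  sentinels x y = x ∷ʳ true , y ∷ʳ false

  inputs : List Input
  inputs = cartesianProductWith sentinels (allBits n) (allBits n)

  #inputs : length inputs ≤ 2 ^ (n + n)
  #inputs = ≤-reflexive (trans (length-cartesianProductWith sentinels (allBits n) (allBits n))
    (trans (cong₂ _*_ (length-allBits n) (length-allBits n)) (sym (^-distribˡ-+-* 2 n n))))

  chosen = Greedy.few-failures inputs (linearHashes (suc n) m) m next fails
    (length-linearHashes>0 (suc n) m) rare k L (n + n) (d , root) #inputs
  table = proj₁ chosen

  open MaxProtocol n k d m L table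

  cost≤ : Cost≤ protocol ((6 * suc m + 1) * k + (6 * suc m + 1))
  cost≤ _ = ≤-reflexive (begin
    depth (erase winnerDialogue)         ≡⟨ depth-erase winnerDialogue ⟩
    k + searchCost m L 1                 ≡⟨ cong (k +_) (searchCost-linear m L 1) ⟩
    k + (L * (2 * suc m) + 1)            ≡⟨ expand k m ⟩
    (6 * suc m + 1) * k + (6 * suc m + 1) ∎)
    where
    open ≡-Reasoning
    expand : ∀ k m → k + (3 * suc k * (2 * suc m) + 1) ≡ (6 * suc m + 1) * k + (6 * suc m + 1)
    expand = solve-∀

  module _ (x y : Bits n) where
    a = sentinels x y
    K = 2 ^ k

    #fail : Bits k → ℕ
    #fail i = failures a (table i) (d , root)

    F = sumL #fail (allBits k)
    G = sumL (𝟙 ∘ good x y) (allBits k)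

    -- The empty prefixes agree; prefixes of length `2 ^ d` are the whole strings, which the
    -- sentinels keep apart.
    initial : Deficit a (d , root) d
    initial = on start≡ end≡
      where
      start≡ : agree a 0 ≡ true
      start≡ = dec-true (≡-dec B._≟_ _ _) (prefix-zero (x ∷ʳ true) (y ∷ʳ false))
      long : suc n ≤ 2 ^ d
      long = ≤-trans (+-mono-≤ (m^n>0 2 k) n≤2^k) (≤-reflexive (cong (K +_) (sym (+-identityʳ K))))
      end≡ : agree a (2 ^ d) ≡ false
      end≡ = dec-false (≡-dec B._≟_ _ _) λ e → ∷ʳ-≢ x y
        (trans (sym (prefix-full long (x ∷ʳ true))) (trans e (prefix-full long (y ∷ʳ false))))

    -- Markov's inequality for a single run: a bad run pays for itself with `suc d` failures.
    good-or-failures : ∀ i → suc d ≤ suc d * 𝟙 (good x y i) + #fail i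
    good-or-failures i with found-or-failures a (table i) initial
    ... | inj₁ fnd rewrite found⇒good x y i fnd = ≤-trans (≤-reflexive (sym (*-identityʳ (suc d)))) (m≤m+n _ (#fail i))
    ... | inj₂ L< = ≤-trans d<#fail (m≤n+m _ _)
      where
      d<#fail : d < #fail i
      d<#fail = *-cancelˡ-< 2 d (#fail i) (+-cancelˡ-< d _ _ L<)

    total : K * suc d ≤ suc d * G + F
    total = begin
      K * suc d
        ≡⟨ sumL-allBits-const k (suc d) ⟨
      sumL (λ _ → suc d) (allBits k)
        ≤⟨ sumL-mono (allBits k) good-or-failures ⟩
      sumL (λ i → suc d * 𝟙 (good x y i) + #fail i) (allBits k)
        ≡⟨ sumL-+ (λ i → suc d * 𝟙 (good x y i)) #fail (allBits k) ⟩
      sumL (λ i → suc d * 𝟙 (good x y i)) (allBits k) + F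
        ≡⟨ cong (_+ F) (sumL-*ˡ (suc d) (𝟙 ∘ good x y) (allBits k)) ⟩
      suc d * G + F ∎
      where open ≤-Reasoning

    qF≤ : q * F ≤ K * suc d
    qF≤ = *-cancelˡ-≤ 3 (begin
      3 * (q * F)          ≡⟨ *-assoc 3 q F ⟨
      m * F                ≤⟨ proj₂ chosen (∈-cartesianProductWith⁺ sentinels (∈-allBits x) (∈-allBits y)) ⟩
      K * L + (n + n)      ≤⟨ +-monoʳ-≤ (K * L) (+-mono-≤ n≤2^k n≤2^k) ⟩
      K * L + (K + K)      ≤⟨ m≤m+n _ K ⟩
      K * L + (K + K) + K  ≡⟨ collect K d ⟩
      3 * (K * suc d)      ∎)
      where
      open ≤-Reasoning
      collect : ∀ K d → K * (3 * d) + (K + K) + K ≡ 3 * (K * suc d)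
      collect = solve-∀

    qK≤ : q * K ≤ q * G + K
    qK≤ = *-cancelʳ-≤ (q * K) (q * G + K) (suc d) (begin
      q * K * suc d              ≡⟨ *-assoc q K (suc d) ⟩
      q * (K * suc d)            ≤⟨ *-monoʳ-≤ q total ⟩
      q * (suc d * G + F)        ≡⟨ distribute q (suc d) G F ⟩
      q * G * suc d + q * F      ≤⟨ +-monoʳ-≤ (q * G * suc d) qF≤ ⟩
      q * G * suc d + K * suc d  ≡⟨ *-distribʳ-+ (suc d) (q * G) K ⟨
      (q * G + K) * suc d        ∎)
      where
      open ≤-Reasoning
      distribute : ∀ q e g f → q * (e * g + f) ≡ q * g * e + q * f
      distribute = solve-∀

    -- At most a fraction `1 / q` of the runs is bad, and this is at most `p / q` because `p` is
    -- positive.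
    enough : (q ∸ p) * K ≤ q * G
    enough = +-cancelʳ-≤ K _ _ (begin
      (q ∸ p) * K + K          ≤⟨ +-monoʳ-≤ ((q ∸ p) * K) (m≤n*m K p {{>-nonZero 0<p}}) ⟩
      (q ∸ p) * K + p * K      ≡⟨ *-distribʳ-+ K (q ∸ p) p ⟨
      (q ∸ p + p) * K          ≡⟨ cong (_* K) (m∸n+n≡m p≤q) ⟩
      q * K                    ≤⟨ qK≤ ⟩
      q * G + K                ∎)
      where open ≤-Reasoning

  error≤ : ErrorAtMost protocol p q (oot-good n)
  error≤ x y = begin
    (q ∸ p) * (1 * 2 ^ k * 1)  ≡⟨ cong ((q ∸ p) *_) (trans (*-identityʳ _) (*-identityˡ (2 ^ k))) ⟩
    (q ∸ p) * 2 ^ k            ≤⟨ enough x y ⟩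
    q * sumL (𝟙 ∘ good x y) (allBits k)  ≡⟨ cong (q *_) (goodCount≡ x y) ⟨
    q * goodCount protocol (λ o → oot-good n o x y) x y ∎
    where open ≤-Reasoning

mainTheorem20 : (p q : ℕ) → 0 < p → 2 * p < q →
    -- R^oot_ε(MAX_n) ∈ O(log n)
    (∃[ C ] ∃[ D ] ((n : ℕ) → OOT≤ p q n (C * ⌈log₂ n ⌉ + D)))
    -- R^uni_ε(MAX_n) ∈ Ω(n)
    × (∃[ C ] ∃[ D ] ((n c : ℕ) → Uni≤ p q n c → n ≤ C * c + D))
    -- same with private coins only
    × (∃[ C ] ∃[ D ] ((n : ℕ) → OOTpriv≤ p q n (C * ⌈log₂ n ⌉ + D)))
    × (∃[ C ] ∃[ D ] ((n c : ℕ) → Unipriv≤ p q n c → n ≤ C * c + D))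
mainTheorem20 p q 0<p 2p<q =
    -- A private-coin protocol is in particular a protocol of the general model, so one construction
    -- serves both upper bounds.
    (B , B , λ n → let π , _ , rest = upper n in π , rest)
  , (1 , 0 , λ n c u → weaken (uni-lower-bound p q n c 2p<q u))
  , (B , B , upper)
  , (1 , 0 , λ n c u → weaken (unipriv-lower-bound p q n c 2p<q u))
  where
  B = 6 * suc (3 * q) + 1
  upper : (n : ℕ) → OOTpriv≤ p q n (B * ⌈log₂ n ⌉ + B)
  upper n = ootpriv-upper-bound p q n ⌈log₂ n ⌉ 0<p (≤-trans (m≤m+n p _) (<⇒≤ 2p<q)) (n≤2^⌈log₂n⌉ n)
  weaken : ∀ {n c} → n ≤ c → n ≤ 1 * c + 0
  weaken n≤c = ≤-trans n≤c (≤-reflexive (sym (trans (+-identityʳ _) (+-identityʳ _))))
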